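{- For every $k$ with $0 \le k < 3$ and every $n > k$, there is no exploration protocol, even probabilistic, of a ring of $n$ nodes with $k$ robots.
   Context: Model. A ring has $n$ nodes $u_0,\dots,u_{n-1}$ (indices modulo $n$), $u_i$ adjacent to $u_{i-1}$ and $u_{i+1}$; nodes are anonymous and the ring is unoriented. There are $k\le n$ robots located on nodes. Robots are anonymous, uniform (same program, no local parameter), oblivious (no memory between cycles) and do not communicate. A protocol is this common program. Each robot repeatedly executes Look–Compute–Move cycles: in Look it observes the number $d_j(t)$ of robots on every node $u_j$ (multiplicity detection), seen from its own node $u_i$ as the unordered pair $\{\gamma^{+i}(t),\gamma^{ -i}(t)\}$ with $\gamma^{+i}(t)=\langle d_i d_{i+1}\dots d_{i+n-1}\rangle$ and $\gamma^{ -i}(t)=\langle d_i d_{i-1}\dots d_{i-(n-1)}\rangle$; in Compute it decides, deterministically or with randomness, to stay idle or move to a neighboring node; in Move it moves. If its view is symmetric ($\gamma^{+i}=\gamma^{ -i}$) and it decides to move, an adversary chooses which incident edge it traverses. At each instant $t=0,1,2,\dots$ a nonempty set of robots is activated, each executing a full cycle atomically between $t$ and $t+1$. The configuration at instant $t$ is $\langle d_0(t)\dots d_{n-1}(t)\rangle$. A tower is a node holding at least two robots; towerless means no tower. A configuration is terminal if from it the probability that some robot moves is 0. A computation is an infinite sequence of configurations starting from a possible (towerless) initial configuration, each obtained from the previous after a nonempty set of robots executes a cycle; it terminates if it contains a terminal configuration. The scheduler is distributed and fair: any nonempty subset may be activated at each instant and every robot is activated infinitely often. A node is visited if some robot is on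 it at some instant. A protocol deterministically (resp. probabilistically) solves exploration — is an exploration protocol — if every computation starting from a towerless configuration terminates in finite time (resp. finite expected time; non-terminating computations have probability 0) and every node is visited by at least one robot during it.
   Formalization: The probabilities with which a robot stays idle or moves are taken to be rational numbers, so the impossibility is proved for probabilistic protocols with rational probabilities (all deterministic protocols included). -}

module Defs where

open import Data.Nat as ℕ using (ℕ; zero; suc; _<_; _≤_)
import Data.Nat.Properties as ℕP
open import Data.Fin as Fin using (Fin; zero; suc; toℕ; fromℕ; fromℕ<; inject₁)
open import Data.Bool using (Bool; true; false; if_then_else_)
open import Data.Product using (Σ; ∃; _×_; _,_)
open import Data.Sum using (_⊎_)
open import Data.List as List using (List; []; _∷_)
import Data.List.Properties as ListP
open import Data.List.Relation.Unary.Any as LAny using ()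
open import Data.Vec as Vec using (Vec; []; _∷_)
open import Data.Vec.Relation.Unary.Any as VAny using ()
open import Data.Vec.Relation.Unary.All as VAll using ()
open import Data.Vec.Membership.Propositional using (_∈_)
open import Data.Rational as ℚ using (ℚ; 0ℚ; 1ℚ)
import Data.Rational.Properties as ℚP
open import Relation.Nullary using (Dec; yes; no; ¬_)
open import Relation.Binary.PropositionalEquality using (_≡_)

csuc : ∀ {n} → Fin n → Fin n
csuc {suc m} i with toℕ i ℕ.<? m
... | yes p = fromℕ< (ℕ.s≤s p)
... | no _  = zero

cpred : ∀ {n} → Fin n → Fin n
cpred {suc m} zero    = fromℕ m
cpred {suc m} (suc i) = inject₁ i

-- Robots.  The k robots are given (for the scheduler's bookkeeping only)
-- by a vector of positions; the protocol never sees identities.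

Pos : ℕ → ℕ → Set
Pos n k = Vec (Fin n) k

mult : ∀ {n k} → Pos n k → Fin n → ℕ
mult ps u = Vec.count (Fin._≟ u) ps

Towerless : ∀ {n k} → Pos n k → Set
Towerless {n} ps = (u : Fin n) → mult ps u ≤ 1

walk : ∀ {n} → (Fin n → Fin n) → ℕ → Fin n → List (Fin n)
walk f zero    i = []
walk f (suc j) i = i ∷ walk f j (f i)

viewPlus : ∀ {n k} → Pos n k → Fin n → List ℕ
viewPlus {n} ps i = List.map (mult ps) (walk csuc n i)

viewMinus : ∀ {n k} → Pos n k → Fin n → List ℕ
viewMinus {n} ps i = List.map (mult ps) (walk cpred n i)

-- Protocol (common program of all robots), possibly probabilistic.
-- Given the view seen as the pair (a , b) of the two directional
-- sequences, a robot stays idle with probability idle a b, moves in the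
-- direction along which it reads a with probability fwd a b, and in the
-- direction along which it reads b with probability bwd a b.
-- Since the view is the UNORDERED pair {a , b}, the program must be
-- invariant under exchanging a and b (swap-idle, swap-fwd).
-- If a ≡ b (symmetric view) the move direction is chosen by the
-- adversary; only the total probability fwd a b + bwd a b matters.

record Protocol : Set where
  field
    idle fwd bwd : List ℕ → List ℕ → ℚ
    idle-nonneg  : ∀ a b → 0ℚ ℚ.≤ idle a b
    fwd-nonneg   : ∀ a b → 0ℚ ℚ.≤ fwd a b
    bwd-nonneg   : ∀ a b → 0ℚ ℚ.≤ bwd a b
    total        : ∀ a b → (idle a b ℚ.+ fwd a b) ℚ.+ bwd a b ≡ 1ℚ
    swap-idle    : ∀ a b → idle a b ≡ idle b a
    swap-fwd     : ∀ a b → fwd a b ≡ bwd b a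

open Protocol public

moveProb : ∀ {n k} → Protocol → Pos n k → Fin n → ℚ
moveProb π ps i = fwd π (viewPlus ps i) (viewMinus ps i) ℚ.+ bwd π (viewPlus ps i) (viewMinus ps i)

Terminal : ∀ {n k} → Protocol → Pos n k → Set
Terminal π ps = VAll.All (λ i → moveProb π ps i ≡ 0ℚ) ps

terminal? : ∀ {n k} (π : Protocol) (ps : Pos n k) → Dec (Terminal π ps)
terminal? π ps = VAll.all? (λ i → moveProb π ps i ℚP.≟ 0ℚ) ps

data Act : Set where
  stay plus minus : Act

isMove : Act → Bool
isMove stay  = false
isMove plus  = true
isMove minus = true

applyAct : ∀ {n} → Act → Fin n → Fin n
applyAct stay  i = i
applyAct plus  i = csuc i
applyAct minus i = cpred i

applyOutcome : ∀ {n k} → Vec Act k → Pos n k → Pos n k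
applyOutcome os ps = Vec.zipWith applyAct os ps

allOutcomes : (k : ℕ) → List (Vec Act k)
allOutcomes zero    = [] ∷ []
allOutcomes (suc k) =
  List.concatMap (λ v → (stay ∷ v) ∷ (plus ∷ v) ∷ (minus ∷ v) ∷ []) (allOutcomes k)

-- Adversary's choice at one instant: the (nonempty if k > 0) set of
-- activated robots, and, for robots with a symmetric view that decide to
-- move, the edge they traverse (true = towards u_{i+1}); the latter may
-- depend on which robots decided to move in this instant.
record Choice (k : ℕ) : Set where
  field
    active   : Vec Bool k
    nonempty : k ≡ 0 ⊎ VAny.Any (_≡ true) active
    dir      : Vec Bool k → Vec Bool k

open Choice public

robotProb : ∀ {n k} → Protocol → Pos n k → Fin n → Bool → Bool → Act → ℚ
robotProb π ps i false dp stay  = 1ℚ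
robotProb π ps i false dp plus  = 0ℚ
robotProb π ps i false dp minus = 0ℚ
robotProb π ps i true dp a with ListP.≡-dec ℕP._≟_ (viewPlus ps i) (viewMinus ps i)
robotProb π ps i true dp stay  | _ = idle π (viewPlus ps i) (viewMinus ps i)
robotProb π ps i true dp plus  | yes _ = if dp then moveProb π ps i else 0ℚ
robotProb π ps i true dp minus | yes _ = if dp then 0ℚ else moveProb π ps i
robotProb π ps i true dp plus  | no _ = fwd π (viewPlus ps i) (viewMinus ps i)
robotProb π ps i true dp minus | no _ = bwd π (viewPlus ps i) (viewMinus ps i)

prodℚ : ∀ {m} → Vec ℚ m → ℚ
prodℚ []       = 1ℚ
prodℚ (x ∷ xs) = x ℚ.* prodℚ xs

sumℚ : List ℚ → ℚ
sumℚ = List.foldr ℚ._+_ 0ℚ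

stepProb : ∀ {n k} → Protocol → Choice k → Pos n k → Vec Act k → ℚ
stepProb {n} {k} π c ps os =
  prodℚ (Vec.zipWith (λ (x : Fin n × Bool) (y : Bool × Act) →
                        let (i , ac) = x ; (dp , a) = y in robotProb π ps i ac dp a)
           (Vec.zip ps (active c))
           (Vec.zip (dir c (Vec.map isMove os)) os))

-- Scheduler / adversary: a strategy mapping the history of robot
-- positions (newest first, never empty) to the choice for the next instant.

Strategy : ℕ → ℕ → Set
Strategy n k = Pos n k → List (Pos n k) → Choice k

past : ∀ {n k} → (ℕ → Pos n k) → ℕ → List (Pos n k)
past run zero    = []
past run (suc t) = run t ∷ past run t

ValidRun : ∀ {n k} → Protocol → Strategy n k → Pos n k → (ℕ → Pos n k) → Set
ValidRun {n} {k} π σ init run =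
  (run 0 ≡ init) ×
  ((t : ℕ) → ∃ λ (os : Vec Act k) →
     (0ℚ ℚ.< stepProb π (σ (run t) (past run t)) (run t) os) ×
     (run (suc t) ≡ applyOutcome os (run t)))

Fair : ∀ {n k} → Protocol → Strategy n k → Pos n k → Set
Fair {n} {k} π σ init =
  (run : ℕ → Pos n k) → ValidRun π σ init run →
  (r : Fin k) (t : ℕ) → ∃ λ t′ → (t ℕ.≤ t′) × (Vec.lookup (active (σ (run t′) (past run t′))) r ≡ true)

survive : ∀ {n k} → Protocol → Strategy n k → Pos n k → List (Pos n k) → ℕ → ℚ
survive π σ cur hist T with terminal? π cur
survive π σ cur hist T       | yes _ = 0ℚ
survive π σ cur hist zero    | no _  = 1ℚ
survive {n} {k} π σ cur hist (suc T) | no _ =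
  sumℚ (List.map (λ os → stepProb π (σ cur hist) cur os ℚ.*
                         survive π σ (applyOutcome os cur) (cur ∷ hist) T)
                 (allOutcomes k))

partialSum : (ℕ → ℚ) → ℕ → ℚ
partialSum f zero    = 0ℚ
partialSum f (suc T) = partialSum f T ℚ.+ f T

-- finite expected termination time:  E[τ] = Σ_{t ≥ 0} P(τ > t) < ∞
FiniteExpectedTime : ∀ {n k} → Protocol → Strategy n k → Pos n k → Set
FiniteExpectedTime π σ init =
  ∃ λ (B : ℚ) → (T : ℕ) → partialSum (survive π σ init []) T ℚ.≤ B

data Reach {n k} (π : Protocol) (σ : Strategy n k) (init : Pos n k)
     : Pos n k → List (Pos n k) → Set where
  start : Reach π σ init init []
  step  : ∀ {cur hist} → Reach π σ init cur hist → (os : Vec Act k) →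
          0ℚ ℚ.< stepProb π (σ cur hist) cur os →
          Reach π σ init (applyOutcome os cur) (cur ∷ hist)

Visited : ∀ {n k} → Fin n → List (Pos n k) → Set
Visited u hs = LAny.Any (λ ps → u ∈ ps) hs

ProbExploration : (n k : ℕ) → Protocol → Set
ProbExploration n k π =
  (init : Pos n k) → Towerless init →
  (σ : Strategy n k) → Fair π σ init →
  FiniteExpectedTime π σ init ×
  (∀ {cur hist} → Reach π σ init cur hist → Terminal π cur →
     (u : Fin n) → Visited u (cur ∷ hist))

{-# OPTIONS --safe #-}

-- Let the scheduler activate one robot at a time, in round-robin order.
-- A towerless configuration leaves a node empty, so it cannot be terminal.
-- With at most two robots, a tower created by moving a single robot lies on
-- a node that was already occupied; if it were terminal, starting from the
-- configuration just before would terminate with an unvisited node.  Hence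
-- no terminal configuration is ever reached, and the termination time is
-- infinite with probability 1.

module Submission where

open import Defs
open import Data.Bool using (Bool; true; false)
open import Data.Fin as Fin using (Fin; zero; suc; toℕ)
import Data.Fin.Properties as FinP
import Data.Integer as ℤ
import Data.Integer.Properties as ℤP
open import Data.List as List using (List; []; _∷_; length)
import Data.List.Properties as ListP
open import Data.List.Relation.Unary.Any using (here; there)
open import Data.Nat as ℕ using (ℕ; zero; suc; _<_; _≤_; z≤n; s≤s)
open import Data.Nat.DivMod using (_mod_; _%_; [m+kn]%n≡m%n; m<n⇒m%n≡m)
import Data.Nat.Properties as ℕP
open import Data.Product using (_×_; _,_; proj₁; proj₂)
open import Data.Rational as ℚ using (ℚ; 0ℚ; 1ℚ; toℚᵘ)
import Data.Rational.Properties as ℚP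
import Data.Rational.Unnormalised as ℚᵘ
import Data.Rational.Unnormalised.Properties as ℚᵘP
open import Data.Sum using (inj₁; inj₂)
open import Data.Vec as Vec using (Vec; []; _∷_)
import Data.Vec.Properties as VecP
open import Data.Vec.Membership.Propositional using (_∈_)
open import Data.Vec.Relation.Unary.All using ([])
open import Data.Vec.Relation.Unary.Any as VAny using (here; there)
open import Data.Vec.Relation.Unary.Any.Properties using (lookup-index)
open import Relation.Binary.Definitions using (tri<; tri≈; tri>)
open import Relation.Binary.PropositionalEquality
open import Relation.Nullary using (¬_; yes; no; contradiction)

-- Sums and products of rationals

-- The value is stated in unnormalised rationals, where the sum is visibly `T` over denominator 1;
-- in `ℚ` each addition is followed by a reduction to lowest terms.
toℚᵘ-partialSum-1 : ∀ {f} → (∀ t → f t ≡ 1ℚ) → ∀ T →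
                    toℚᵘ (partialSum f T) ℚᵘ.≃ ℚᵘ.mkℚᵘ (ℤ.+ T) 0
toℚᵘ-partialSum-1 f≡1 zero = ℚᵘP.≃-refl
toℚᵘ-partialSum-1 {f} f≡1 (suc T) = begin
  toℚᵘ (partialSum f T ℚ.+ f T)         ≡⟨ cong (λ q → toℚᵘ (partialSum f T ℚ.+ q)) (f≡1 T) ⟩
  toℚᵘ (partialSum f T ℚ.+ 1ℚ)          ≈⟨ ℚP.toℚᵘ-homo-+ (partialSum f T) 1ℚ ⟩
  toℚᵘ (partialSum f T) ℚᵘ.+ ℚᵘ.1ℚᵘ     ≈⟨ ℚᵘP.+-congˡ ℚᵘ.1ℚᵘ (toℚᵘ-partialSum-1 f≡1 T) ⟩
  ℚᵘ.mkℚᵘ (ℤ.+ T) 0 ℚᵘ.+ ℚᵘ.1ℚᵘ         ≡⟨ cong (λ z → ℚᵘ.mkℚᵘ z 0) T*1+1≡1+T ⟩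
  ℚᵘ.mkℚᵘ (ℤ.+ suc T) 0                 ∎
  where
  open ℚᵘP.≃-Reasoning
  T*1+1≡1+T : (ℤ.+ T) ℤ.* (ℤ.+ 1) ℤ.+ (ℤ.+ 1) ≡ ℤ.+ suc T
  T*1+1≡1+T = trans (cong (ℤ._+ ℤ.+ 1) (ℤP.*-identityʳ (ℤ.+ T))) (cong ℤ.+_ (ℕP.+-comm T 1))

partialSum-1-unbounded : ∀ {f} → (∀ t → f t ≡ 1ℚ) → (B : ℚ) →
                         ¬ (∀ T → partialSum f T ℚ.≤ B)
partialSum-1-unbounded {f} f≡1 B@record{} bounded = ℤP.<-irrefl refl (begin-strict
  p                          ≤⟨ p≤+∣p∣ p ⟩
  ℤ.+ ℤ.∣ p ∣                <⟨ ℤ.+<+ (ℕP.n<1+n ℤ.∣ p ∣) ⟩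
  ℤ.+ T                      ≤⟨ ℤ.+≤+ (ℕP.m≤m*n T (suc d)) ⟩
  ℤ.+ (T ℕ.* suc d)          ≡⟨ ℤP.pos-* T (suc d) ⟩
  ℤ.+ T ℤ.* ℤ.+ suc d        ≤⟨ ℚᵘP.drop-*≤* T≤B ⟩
  p ℤ.* ℤ.+ 1                ≡⟨ ℤP.*-identityʳ p ⟩
  p                          ∎)
  where
  open ℤP.≤-Reasoning
  p = ℚ.numerator B
  d = ℚ.denominator-1 B
  -- With `B` equal to `p / (d + 1)`, this `T` gives `T * (d + 1) ≥ T > p`, hence `T > B`.
  T = suc ℤ.∣ p ∣
  T≤B : ℚᵘ.mkℚᵘ (ℤ.+ T) 0 ℚᵘ.≤ toℚᵘ B
  T≤B = ℚᵘP.≤-respˡ-≃ (toℚᵘ-partialSum-1 f≡1 T) (ℚP.toℚᵘ-mono-≤ (bounded T))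
  p≤+∣p∣ : ∀ i → i ℤ.≤ ℤ.+ ℤ.∣ i ∣
  p≤+∣p∣ (ℤ.+ n)      = ℤP.≤-refl
  p≤+∣p∣ (ℤ.-[1+ n ]) = ℤ.-≤+

*-nonneg : ∀ {p q} → 0ℚ ℚ.≤ p → 0ℚ ℚ.≤ q → 0ℚ ℚ.≤ p ℚ.* q
*-nonneg {p} {q} 0≤p 0≤q = subst (ℚ._≤ p ℚ.* q) (ℚP.*-zeroʳ p)
  (ℚP.*-monoˡ-≤-nonNeg p {{ℚ.nonNegative 0≤p}} 0≤q)

-- Product laws on outcomes

module _ {X : Set} (f : X → Bool × Act → ℚ) where

  -- The shape of `stepProb` when the direction bits `ds` do not depend on the outcome; an element
  -- of `X` then stands for a node with an activation flag.
  outcomeProb : ∀ {k} → Vec X k → Vec Bool k → Vec Act k → ℚ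
  outcomeProb xs ds os = prodℚ (Vec.zipWith f xs (Vec.zip ds os))

  outcomeProb-nonneg : (∀ x y → 0ℚ ℚ.≤ f x y) → ∀ {k} (xs : Vec X k) ds os →
                       0ℚ ℚ.≤ outcomeProb xs ds os
  outcomeProb-nonneg 0≤f []       []       []       = ℚP.nonNegative⁻¹ 1ℚ
  outcomeProb-nonneg 0≤f (x ∷ xs) (d ∷ ds) (o ∷ os) =
    *-nonneg (0≤f x (d , o)) (outcomeProb-nonneg 0≤f xs ds os)

  -- Summing out the first robot: for each tail `v` of weight `w`, its three acts contribute
  -- `(a + b + c) * w`, and `a + b + c` is 1.
  sum-concatMap-acts :
    (∀ x d → (f x (d , stay) ℚ.+ f x (d , plus)) ℚ.+ f x (d , minus) ≡ 1ℚ) →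
    ∀ {k} x d (xs : Vec X k) ds (l : List (Vec Act k)) →
    sumℚ (List.map (outcomeProb (x ∷ xs) (d ∷ ds))
           (List.concatMap (λ v → (stay ∷ v) ∷ (plus ∷ v) ∷ (minus ∷ v) ∷ []) l))
    ≡ sumℚ (List.map (outcomeProb xs ds) l)
  sum-concatMap-acts Σf≡1 x d xs ds []      = refl
  sum-concatMap-acts Σf≡1 x d xs ds (v ∷ l) = begin
    a ℚ.* w ℚ.+ (b ℚ.* w ℚ.+ (c ℚ.* w ℚ.+ rest))
      ≡⟨ cong (λ q → a ℚ.* w ℚ.+ (b ℚ.* w ℚ.+ (c ℚ.* w ℚ.+ q))) (sum-concatMap-acts Σf≡1 x d xs ds l) ⟩
    a ℚ.* w ℚ.+ (b ℚ.* w ℚ.+ (c ℚ.* w ℚ.+ s))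
      ≡⟨ cong (a ℚ.* w ℚ.+_) (ℚP.+-assoc (b ℚ.* w) (c ℚ.* w) s) ⟨
    a ℚ.* w ℚ.+ ((b ℚ.* w ℚ.+ c ℚ.* w) ℚ.+ s)
      ≡⟨ ℚP.+-assoc (a ℚ.* w) _ s ⟨
    (a ℚ.* w ℚ.+ (b ℚ.* w ℚ.+ c ℚ.* w)) ℚ.+ s
      ≡⟨ cong (ℚ._+ s) (ℚP.+-assoc (a ℚ.* w) (b ℚ.* w) (c ℚ.* w)) ⟨
    ((a ℚ.* w ℚ.+ b ℚ.* w) ℚ.+ c ℚ.* w) ℚ.+ s
      ≡⟨ cong (λ q → (q ℚ.+ c ℚ.* w) ℚ.+ s) (ℚP.*-distribʳ-+ w a b) ⟨
    ((a ℚ.+ b) ℚ.* w ℚ.+ c ℚ.* w) ℚ.+ s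
      ≡⟨ cong (ℚ._+ s) (ℚP.*-distribʳ-+ w (a ℚ.+ b) c) ⟨
    ((a ℚ.+ b) ℚ.+ c) ℚ.* w ℚ.+ s
      ≡⟨ cong (λ q → q ℚ.* w ℚ.+ s) (Σf≡1 x d) ⟩
    1ℚ ℚ.* w ℚ.+ s
      ≡⟨ cong (ℚ._+ s) (ℚP.*-identityˡ w) ⟩
    w ℚ.+ s ∎
    where
    open ≡-Reasoning
    a = f x (d , stay)
    b = f x (d , plus)
    c = f x (d , minus)
    w = outcomeProb xs ds v
    s = sumℚ (List.map (outcomeProb xs ds) l)
    rest = sumℚ (List.map (outcomeProb (x ∷ xs) (d ∷ ds))
             (List.concatMap (λ v → (stay ∷ v) ∷ (plus ∷ v) ∷ (minus ∷ v) ∷ []) l))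

  sum-outcomeProb≡1 :
    (∀ x d → (f x (d , stay) ℚ.+ f x (d , plus)) ℚ.+ f x (d , minus) ≡ 1ℚ) →
    ∀ {k} (xs : Vec X k) ds →
    sumℚ (List.map (outcomeProb xs ds) (allOutcomes k)) ≡ 1ℚ
  sum-outcomeProb≡1 Σf≡1 []       []       = refl
  sum-outcomeProb≡1 Σf≡1 (x ∷ xs) (d ∷ ds) =
    trans (sum-concatMap-acts Σf≡1 x d xs ds (allOutcomes _)) (sum-outcomeProb≡1 Σf≡1 xs ds)

-- The law of one robot's action

module _ {n k : ℕ} (π : Protocol) (ps : Pos n k) where

  moveProb-nonneg : ∀ i → 0ℚ ℚ.≤ moveProb π ps i
  moveProb-nonneg i = ℚP.+-mono-≤ (fwd-nonneg π a b) (bwd-nonneg π a b)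
    where
    a = viewPlus ps i
    b = viewMinus ps i

  robotProb-nonneg : ∀ i ac dp a → 0ℚ ℚ.≤ robotProb π ps i ac dp a
  robotProb-nonneg i false dp stay  = ℚP.nonNegative⁻¹ 1ℚ
  robotProb-nonneg i false dp plus  = ℚP.≤-refl
  robotProb-nonneg i false dp minus = ℚP.≤-refl
  robotProb-nonneg i true  dp a with ListP.≡-dec ℕP._≟_ (viewPlus ps i) (viewMinus ps i)
  robotProb-nonneg i true  dp    stay  | _     = idle-nonneg π _ _
  robotProb-nonneg i true  true  plus  | yes _ = moveProb-nonneg i
  robotProb-nonneg i true  false plus  | yes _ = ℚP.≤-refl
  robotProb-nonneg i true  true  minus | yes _ = ℚP.≤-refl
  robotProb-nonneg i true  false minus | yes _ = moveProb-nonneg i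
  robotProb-nonneg i true  dp    plus  | no _  = fwd-nonneg π _ _
  robotProb-nonneg i true  dp    minus | no _  = bwd-nonneg π _ _

  -- For a symmetric view all of `moveProb` goes to the edge picked by the adversary and 0 to the
  -- other, so both views reduce to `total`.
  sum-robotProb : ∀ i ac dp →
    (robotProb π ps i ac dp stay ℚ.+ robotProb π ps i ac dp plus) ℚ.+ robotProb π ps i ac dp minus ≡ 1ℚ
  sum-robotProb i false dp = refl
  sum-robotProb i true  dp with ListP.≡-dec ℕP._≟_ (viewPlus ps i) (viewMinus ps i)
  sum-robotProb i true  dp    | no _  = total π _ _
  sum-robotProb i true  true  | yes _ =
    trans (ℚP.+-identityʳ _) (trans (sym (ℚP.+-assoc (idle π _ _) _ _)) (total π _ _))
  sum-robotProb i true  false | yes _ =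
    trans (cong (ℚ._+ moveProb π ps i) (ℚP.+-identityʳ (idle π a b)))
      (trans (sym (ℚP.+-assoc (idle π a b) _ _)) (total π a b))
    where
    a = viewPlus ps i
    b = viewMinus ps i

-- Round-robin scheduling

activateOnly : ∀ {k} → Fin k → Choice k
activateOnly {k} r = record
  { active   = Vec.replicate k false Vec.[ r ]≔ true
  ; nonempty = inj₂ (singleton-true r)
  -- A constant choice, so that the step law is an instance of `outcomeProb`.
  ; dir      = λ _ → Vec.replicate k true
  }
  where
  singleton-true : ∀ {m} (r : Fin m) → VAny.Any (_≡ true) (Vec.replicate m false Vec.[ r ]≔ true)
  singleton-true zero    = here refl
  singleton-true (suc r) = there (singleton-true r)

-- c is the index, modulo the number of robots, of the first activated robot.
roundRobin : ∀ {n m} → ℕ → Strategy n (suc m)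
roundRobin {m = m} c cur hist = activateOnly ((length hist ℕ.+ c) mod suc m)

length-past : ∀ {n k} (run : ℕ → Pos n k) t → length (past run t) ≡ t
length-past run zero    = refl
length-past run (suc t) = cong suc (length-past run t)

toℕ-mod : ∀ {m} (r : Fin (suc m)) → toℕ r mod suc m ≡ r
toℕ-mod {m} r = FinP.toℕ-injective
  (trans (FinP.toℕ-fromℕ< _) (m<n⇒m%n≡m (FinP.toℕ<n r)))

roundRobin-fair : ∀ {n m} π c (init : Pos n (suc m)) → Fair π (roundRobin c) init
roundRobin-fair {n} {m} π c init run valid r t =
  t′ , t≤t′ , trans (cong (λ s → Vec.lookup (active (activateOnly s)) r) turn≡r)
    (VecP.lookup∘updateAt r (Vec.replicate (suc m) false))
  where
  -- `N` is congruent to `r` modulo the number of robots and at least `c + t`, so instant `N - c` is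
  -- not before `t` and is a turn of `r`.
  N = toℕ r ℕ.+ (c ℕ.+ t) ℕ.* suc m
  t′ = N ℕ.∸ c
  c+t≤N : c ℕ.+ t ≤ N
  c+t≤N = ℕP.≤-trans (ℕP.m≤m*n (c ℕ.+ t) (suc m)) (ℕP.m≤n+m _ (toℕ r))
  t≤t′ : t ≤ t′
  t≤t′ = ℕP.≤-trans (ℕP.≤-reflexive (sym (ℕP.m+n∸m≡n c t))) (ℕP.∸-monoˡ-≤ c c+t≤N)
  turn≡r : (length (past run t′) ℕ.+ c) mod suc m ≡ r
  turn≡r = FinP.toℕ-injective (begin
    toℕ ((length (past run t′) ℕ.+ c) mod suc m)  ≡⟨ FinP.toℕ-fromℕ< _ ⟩
    (length (past run t′) ℕ.+ c) % suc m          ≡⟨ cong (λ l → (l ℕ.+ c) % suc m) (length-past run t′) ⟩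
    (t′ ℕ.+ c) % suc m                            ≡⟨ cong (_% suc m) (ℕP.m∸n+n≡m (ℕP.≤-trans (ℕP.m≤m+n c t) c+t≤N)) ⟩
    N % suc m                                     ≡⟨ [m+kn]%n≡m%n (toℕ r) (c ℕ.+ t) (suc m) ⟩
    toℕ r % suc m                                 ≡⟨ m<n⇒m%n≡m (FinP.toℕ<n r) ⟩
    toℕ r                                         ∎)
    where open ≡-Reasoning

-- Survival under single activations

module _ {n k : ℕ} (π : Protocol) (r : Fin k) (cur : Pos n k) where

  stepProb-activateOnly-nonneg : ∀ os → 0ℚ ℚ.≤ stepProb π (activateOnly r) cur os
  stepProb-activateOnly-nonneg os = outcomeProb-nonneg _
    (λ x y → robotProb-nonneg π cur (proj₁ x) (proj₂ x) (proj₁ y) (proj₂ y))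
    (Vec.zip cur (active (activateOnly r))) (Vec.replicate k true) os

  sum-stepProb-activateOnly :
    sumℚ (List.map (stepProb π (activateOnly r) cur) (allOutcomes k)) ≡ 1ℚ
  sum-stepProb-activateOnly = sum-outcomeProb≡1 _
    (λ x d → sum-robotProb π cur (proj₁ x) (proj₂ x) d)
    (Vec.zip cur (active (activateOnly r))) (Vec.replicate k true)

PreservesNonterminal : ℕ → ℕ → Protocol → Set
PreservesNonterminal n k π = (cur : Pos n k) (r : Fin k) (os : Vec Act k) →
  0ℚ ℚ.< stepProb π (activateOnly r) cur os →
  ¬ Terminal π cur → ¬ Terminal π (applyOutcome os cur)

-- By induction on the horizon, an outcome of positive probability leads to survival probability 1,
-- and one of probability 0 contributes 0 in any case. Each summand thus equals its step
-- probability, and these add up to 1.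
survive-roundRobin : ∀ {n m} π → PreservesNonterminal n (suc m) π →
  ∀ c cur → ¬ Terminal π cur → ∀ hist T → survive π (roundRobin c) cur hist T ≡ 1ℚ
survive-roundRobin π preserves c cur nt hist T with terminal? π cur
survive-roundRobin π preserves c cur nt hist T       | yes term = contradiction term nt
survive-roundRobin π preserves c cur nt hist zero    | no _ = refl
survive-roundRobin {m = m} π preserves c cur nt hist (suc T) | no _ =
  trans (cong sumℚ (ListP.map-cong weighted (allOutcomes (suc m)))) (sum-stepProb-activateOnly π r cur)
  where
  r = (length hist ℕ.+ c) mod suc m
  weighted : ∀ os →
    stepProb π (activateOnly r) cur os ℚ.* survive π (roundRobin c) (applyOutcome os cur) (cur ∷ hist) T
    ≡ stepProb π (activateOnly r) cur os
  weighted os with ℚP.<-cmp 0ℚ (stepProb π (activateOnly r) cur os)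
  ... | tri< 0<p _ _ = trans
    (cong (stepProb π (activateOnly r) cur os ℚ.*_)
      (survive-roundRobin π preserves c _ (preserves cur r os 0<p nt) (cur ∷ hist) T))
    (ℚP.*-identityʳ _)
  ... | tri≈ _ 0≡p _ = trans
    (cong (ℚ._* survive π (roundRobin c) (applyOutcome os cur) (cur ∷ hist) T) (sym 0≡p))
    (trans (ℚP.*-zeroˡ (survive π (roundRobin c) (applyOutcome os cur) (cur ∷ hist) T)) 0≡p)
  ... | tri> _ _ p<0 = contradiction (ℚP.<-≤-trans p<0 (stepProb-activateOnly-nonneg π r cur os)) (ℚP.<-irrefl refl)

-- Terminal configurations of an exploration protocol

-- Sending each node to the index of a robot on it maps `n` nodes to `k < n` indices; two nodes
-- sharing an index would be the position of the same robot.
some-node-empty : ∀ {n k} → k < n → (ps : Pos n k) → ¬ (∀ u → u ∈ ps)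
some-node-empty k<n ps all∈
  with i , j , i<j , same ← FinP.pigeonhole k<n (λ u → VAny.index (all∈ u))
  = FinP.<⇒≢ i<j (begin
      i                                  ≡⟨ lookup-index (all∈ i) ⟩
      Vec.lookup ps (VAny.index (all∈ i)) ≡⟨ cong (Vec.lookup ps) same ⟩
      Vec.lookup ps (VAny.index (all∈ j)) ≡⟨ lookup-index (all∈ j) ⟨
      j                                  ∎)
  where open ≡-Reasoning

module _ {n m : ℕ} (k<n : suc m < n) {π : Protocol} (explores : ProbExploration n (suc m) π) where

  towerless⇒nonterminal : (ps : Pos n (suc m)) → Towerless ps → ¬ Terminal π ps
  towerless⇒nonterminal ps tl term = some-node-empty k<n ps visited
    where
    visited : ∀ u → u ∈ ps
    -- The computation is already over at instant 0, so its history consists of `ps` alone.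
    visited u with proj₂ (explores ps tl (roundRobin 0) (roundRobin-fair π 0 ps)) start term u
    ... | here u∈ps = u∈ps

  -- The step is the first one of a fair round-robin run with offset `toℕ r`. Stopping after it
  -- would leave only the nodes of `ps` visited, and these are not all nodes.
  no-new-node⇒nonterminal : ∀ ps → Towerless ps → ∀ r os →
    0ℚ ℚ.< stepProb π (activateOnly r) ps os →
    (∀ {u} → u ∈ applyOutcome os ps → u ∈ ps) → ¬ Terminal π (applyOutcome os ps)
  no-new-node⇒nonterminal ps tl r os 0<p ⊆ps term = some-node-empty k<n ps visited
    where
    0<p′ : 0ℚ ℚ.< stepProb π (activateOnly (toℕ r mod suc m)) ps os
    -- The history is empty at the first instant, so the offset alone determines the activated
    -- robot.
    0<p′ = subst (λ s → 0ℚ ℚ.< stepProb π (activateOnly s) ps os) (sym (toℕ-mod r)) 0<p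
    visited : ∀ u → u ∈ ps
    visited u with proj₂ (explores ps tl (roundRobin (toℕ r)) (roundRobin-fair π (toℕ r) ps))
                     (step start os 0<p′) term u
    ... | here u∈next        = ⊆ps u∈next
    ... | there (here u∈ps)  = u∈ps

  -- Survival has probability 1 at every horizon, so the partial sums for the expected time grow
  -- without bound.
  preserving⇒not-exploration : (init : Pos n (suc m)) → Towerless init →
    ¬ PreservesNonterminal n (suc m) π
  preserving⇒not-exploration init tl preserves
    with B , bounded ← proj₁ (explores init tl (roundRobin 0) (roundRobin-fair π 0 init))
    = partialSum-1-unbounded
        (survive-roundRobin π preserves 0 init (towerless⇒nonterminal init tl) []) B bounded

-- Configurations of one and two robots

towerless-1 : ∀ {n} (ps : Pos n 1) → Towerless ps
towerless-1 ps u = VecP.count≤n (Fin._≟ u) ps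

towerless-2 : ∀ {n} {x y : Fin n} → x ≢ y → Towerless (x ∷ y ∷ [])
towerless-2 {x = x} {y} x≢y u with x Fin.≟ u
... | no _    = towerless-1 (y ∷ []) u
... | yes refl with y Fin.≟ u
...   | yes refl = contradiction refl x≢y
...   | no _     = s≤s z≤n

-- A move of a robot that is not activated has probability 0, and this factor annihilates the whole
-- product.
inactive-first-stays : ∀ {n} π (x y : Fin n) o o′ →
  0ℚ ℚ.< stepProb π (activateOnly (suc zero)) (x ∷ y ∷ []) (o ∷ o′ ∷ []) → o ≡ stay
inactive-first-stays π x y stay  o′ 0<p = refl
inactive-first-stays π x y plus  o′ 0<p =
  contradiction (sym (ℚP.*-zeroˡ (robotProb π (x ∷ y ∷ []) y true true o′ ℚ.* 1ℚ))) (ℚP.<⇒≢ 0<p)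
inactive-first-stays π x y minus o′ 0<p =
  contradiction (sym (ℚP.*-zeroˡ (robotProb π (x ∷ y ∷ []) y true true o′ ℚ.* 1ℚ))) (ℚP.<⇒≢ 0<p)

inactive-second-stays : ∀ {n} π (x y : Fin n) o o′ →
  0ℚ ℚ.< stepProb π (activateOnly zero) (x ∷ y ∷ []) (o ∷ o′ ∷ []) → o′ ≡ stay
inactive-second-stays π x y o stay  0<p = refl
inactive-second-stays π x y o plus  0<p =
  contradiction (sym (ℚP.*-zeroʳ (robotProb π (x ∷ y ∷ []) x true true o))) (ℚP.<⇒≢ 0<p)
inactive-second-stays π x y o minus 0<p =
  contradiction (sym (ℚP.*-zeroʳ (robotProb π (x ∷ y ∷ []) x true true o))) (ℚP.<⇒≢ 0<p)

-- A step of a single robot that ends in a tower either starts from the same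
-- tower or puts both robots on a node occupied before.
two-robots-preserve : ∀ {n π} → 2 < n → ProbExploration n 2 π → PreservesNonterminal n 2 π
two-robots-preserve {π = π} 2<n explores (x ∷ y ∷ []) zero (o ∷ o′ ∷ []) 0<p nt
  with refl ← inactive-second-stays π x y o o′ 0<p | applyAct o x Fin.≟ y | x Fin.≟ y
... | no  x′≢y | _        = towerless⇒nonterminal 2<n explores _ (towerless-2 x′≢y)
... | yes x′≡y | yes x≡y  = subst (λ z → ¬ Terminal π (z ∷ y ∷ [])) (trans x≡y (sym x′≡y)) nt
... | yes x′≡y | no  x≢y  =
  no-new-node⇒nonterminal 2<n explores _ (towerless-2 x≢y) zero (o ∷ stay ∷ []) 0<p
    λ { (here u≡x′) → there (here (trans u≡x′ x′≡y)) ; (there u∈) → there u∈ }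
two-robots-preserve {π = π} 2<n explores (x ∷ y ∷ []) (suc zero) (o ∷ o′ ∷ []) 0<p nt
  with refl ← inactive-first-stays π x y o o′ 0<p | x Fin.≟ applyAct o′ y | x Fin.≟ y
... | no  x≢y′ | _        = towerless⇒nonterminal 2<n explores _ (towerless-2 x≢y′)
... | yes x≡y′ | yes x≡y  = subst (λ z → ¬ Terminal π (x ∷ z ∷ [])) (trans (sym x≡y) x≡y′) nt
... | yes x≡y′ | no  x≢y  =
  no-new-node⇒nonterminal 2<n explores _ (towerless-2 x≢y) (suc zero) (stay ∷ o′ ∷ []) 0<p
    λ { (here u≡x) → here u≡x ; (there (here u≡y′)) → here (trans u≡y′ (sym x≡y′)) }

theorem1 : (k n : ℕ) → k < 3 → k < n → (π : Protocol) → ¬ ProbExploration n k π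
-- With no robots the empty configuration is vacuously terminal and every scheduler is vacuously
-- fair, yet node `zero` is never visited.
theorem1 0 (suc n) _ _ π explores
  with proj₂ (explores [] (λ _ → z≤n)
         (λ _ _ → record { active = [] ; nonempty = inj₁ refl ; dir = λ _ → [] })
         (λ _ _ ())) start [] zero
... | here ()
... | there ()
theorem1 1 n@(suc _) _ k<n π explores =
  preserving⇒not-exploration k<n explores (zero ∷ []) (towerless-1 (zero ∷ []))
    -- A single robot never forms a tower, so no configuration at all is terminal.
    (λ cur r os _ _ → towerless⇒nonterminal k<n explores _ (towerless-1 (applyOutcome os cur)))
theorem1 2 n@(suc (suc _)) _ k<n π explores =
  preserving⇒not-exploration k<n explores (zero ∷ suc zero ∷ []) (towerless-2 {x = zero} {suc zero} λ ())
    (two-robots-preserve k<n explores)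
theorem1 (suc (suc (suc _))) _ (s≤s (s≤s (s≤s ()))) _ _ _
theorem1 1 zero _ () _ _
theorem1 2 (suc zero) _ (s≤s ()) _ _
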